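{- For $i=1,2$ let $\mathcal L_i=\langle C_i,\models_{M_i}\rangle$ be non-trivial matrix logics, where $M_i=(\mathbf A_i,D_i)$ is a $C_i$-matrix with universe $A_i$, and let $(\lambda,\mu)$ be a fibring pair, i.e. $\lambda:A_1\to A_2$ and $\mu:A_2\to A_1$. Then $[\mathcal L_1\circledast\mathcal L_2]_{(\lambda,\mu)}$ is a weak conservative extension of both $\mathcal L_1$ and $\mathcal L_2$: for each $i\in\{1,2\}$ and each $\varphi\in L(C_i)$, $\models_{M_i}\varphi$ if and only if $\models_{(M_1\circledast M_2)_{(\lambda,\mu)}}\varphi$.
   Context: Fix a countable set $\mathcal V=\{p_1,p_2,\dots\}$ of propositional variables. A signature $C=\{C^k\}_{k\in\mathbb N}$ is a family of pairwise disjoint sets, disjoint from $\mathcal V$ ($C^k$ is the set of $k$-ary connectives); $L(C)$ is the absolutely free algebra over $C$ generated by $\mathcal V$. A $C$-matrix is $M=(\mathbf A,D)$ with $\mathbf A$ a $C$-algebra with universe $A$ and $D\subseteq A$. An $M$-valuation is a homomorphism $v:L(C)\to\mathbf A$. $\Gamma\models_M\varphi$ means: for every $M$-valuation $v$, $v(\Gamma)\subseteq D$ implies $v(\varphi)\in D$; $\models_M\varphi$ means $\emptyset\models_M\varphi$. A matrix logic here is a pair $\langle C,\models_M\rangle$. A logic $\langle C,\vdash\rangle$ is trivial if $\Gamma\vdash\varphi$ for every $\Gamma\cup\{\varphi\}\subseteq L(C)$, and non-trivial otherwise. Put $C_\circledast=C_1\uplus C_2$, $A_\circledast=A_1\uplus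 A_2$, $D_\circledast=D_1\uplus D_2$ (disjoint unions; $L(C_i)$ is regarded as a subset of $L(C_\circledast)$). Define $\ast_\lambda:A_\circledast\to A_2$ by $\ast_\lambda(x)=\lambda(x)$ if $x\in A_1$, $\ast_\lambda(x)=x$ if $x\in A_2$; and $\ast_\mu:A_\circledast\to A_1$ by $\ast_\mu(x)=x$ if $x\in A_1$, $\ast_\mu(x)=\mu(x)$ if $x\in A_2$. The fibred $C_\circledast$-matrix $(M_1\circledast M_2)_{(\lambda,\mu)}$ has universe $A_\circledast$, designated set $D_\circledast$, and operations $c(x_1,\dots,x_k)=c^{\mathbf A_1}(\ast_\mu(x_1),\dots,\ast_\mu(x_k))$ for $c\in C_1^k$ and $c(x_1,\dots,x_k)=c^{\mathbf A_2}(\ast_\lambda(x_1),\dots,\ast_\lambda(x_k))$ for $c\in C_2^k$. The fibring by functions is $[\mathcal L_1\circledast\mathcal L_2]_{(\lambda,\mu)}=\langle C_\circledast,\models_{(M_1\circledast M_2)_{(\lambda,\mu)}}\rangle$. -}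

module Defs where

open import Level using (Level; suc)
open import Data.Nat.Base using (ℕ)
open import Data.Product.Base using (_×_; _,_; proj₁; proj₂)
open import Data.Sum.Base using (_⊎_; inj₁; inj₂; [_,_])
open import Data.Vec.Base using (Vec; []; _∷_; map)
open import Function.Base using (id)
open import Function.Bundles using (_⇔_)
open import Relation.Binary.PropositionalEquality.Core using (_≡_)
open import Relation.Nullary.Negation.Core using (¬_)
open import Relation.Unary using (Pred; _∈_; _⟨⊎⟩_)
open import Relation.Unary.Polymorphic using (∅)

private
  variable
    ℓ : Level

-- C k is the type of k-ary connectives.  Formulas record the arity of each
-- connective and tag variables separately, so the disjointness conditions on
-- a signature hold by construction.

Signature : (ℓ : Level) → Set (suc ℓ)
Signature ℓ = ℕ → Set ℓ

record Algebra (C : Signature ℓ) : Set (suc ℓ) where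
  field
    Carrier : Set ℓ
    ⟦_⟧     : ∀ {k} → C k → Vec Carrier k → Carrier

open Algebra public

-- Formulas over the countable set of variables p₀, p₁, p₂, …

data Formula (C : Signature ℓ) : Set ℓ where
  var : ℕ → Formula C
  con : ∀ {k} → C k → Vec (Formula C) k → Formula C

L : (C : Signature ℓ) → Algebra C
L C = record { Carrier = Formula C ; ⟦_⟧ = con }

record Homomorphism {C : Signature ℓ} (A B : Algebra C) : Set ℓ where
  field
    fun : Carrier A → Carrier B
    hom : ∀ {k} (c : C k) (xs : Vec (Carrier A) k) →
          fun (⟦ A ⟧ c xs) ≡ ⟦ B ⟧ c (map fun xs)

open Homomorphism public

record Matrix (C : Signature ℓ) : Set (suc ℓ) where
  field
    algebra    : Algebra C
    Designated : Pred (Carrier algebra) ℓ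

  Universe : Set ℓ
  Universe = Carrier algebra

open Matrix public

Valuation : {C : Signature ℓ} → Matrix C → Set ℓ
Valuation {C = C} M = Homomorphism (L C) (algebra M)

Consequence : {C : Signature ℓ} → Matrix C → Pred (Formula C) ℓ → Formula C → Set ℓ
Consequence M Γ φ =
  (v : Valuation M) → (∀ ψ → ψ ∈ Γ → fun v ψ ∈ Designated M) → fun v φ ∈ Designated M

record Logic (ℓ : Level) : Set (suc ℓ) where
  constructor ⟨_,_⟩
  field
    signature : Signature ℓ
    entails   : Pred (Formula signature) ℓ → Formula signature → Set ℓ

open Logic public

Trivial : Logic ℓ → Set (suc ℓ)
Trivial 𝓛 = ∀ Γ φ → entails 𝓛 Γ φ

NonTrivial : Logic ℓ → Set (suc ℓ)
NonTrivial 𝓛 = ¬ Trivial 𝓛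

matrixLogic : {C : Signature ℓ} → Matrix C → Logic ℓ
matrixLogic {C = C} M = ⟨ C , Consequence M ⟩

_⊎ˢ_ : Signature ℓ → Signature ℓ → Signature ℓ
(C₁ ⊎ˢ C₂) k = C₁ k ⊎ C₂ k

-- The map on formulas induced by a map of signatures.  For the injections
-- into C₁ ⊎ˢ C₂ it is the identification of L(Cᵢ) with a subset of
-- L(C₁ ⊎ˢ C₂).

module _ {C C′ : Signature ℓ} (σ : ∀ {k} → C k → C′ k) where
  translate  : Formula C → Formula C′
  translates : ∀ {k} → Vec (Formula C) k → Vec (Formula C′) k

  translate (var n)    = var n
  translate (con c φs) = con (σ c) (translates φs)

  translates []       = []
  translates (φ ∷ φs) = translate φ ∷ translates φs

-- The map of signatures plays the role of the inclusion of the smaller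
-- signature into the larger one.

WeakConservativeExtension : (𝓛 𝓛′ : Logic ℓ) →
  (∀ {k} → signature 𝓛 k → signature 𝓛′ k) → Set ℓ
WeakConservativeExtension 𝓛 𝓛′ σ =
  ∀ φ → entails 𝓛 ∅ φ ⇔ entails 𝓛′ ∅ (translate σ φ)

FibringPair : {C₁ C₂ : Signature ℓ} → Matrix C₁ → Matrix C₂ → Set ℓ
FibringPair M₁ M₂ = (Universe M₁ → Universe M₂) × (Universe M₂ → Universe M₁)

module _ {C₁ C₂ : Signature ℓ} (M₁ : Matrix C₁) (M₂ : Matrix C₂)
         (pair : FibringPair M₁ M₂) where

  ∗λ : Universe M₁ ⊎ Universe M₂ → Universe M₂
  ∗λ = [ proj₁ pair , id ]

  ∗μ : Universe M₁ ⊎ Universe M₂ → Universe M₁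
  ∗μ = [ id , proj₂ pair ]

  fibredAlgebra : Algebra (C₁ ⊎ˢ C₂)
  fibredAlgebra = record
    { Carrier = Universe M₁ ⊎ Universe M₂
    ; ⟦_⟧     = λ { (inj₁ c) xs → inj₁ (⟦ algebra M₁ ⟧ c (map ∗μ xs))
                  ; (inj₂ c) xs → inj₂ (⟦ algebra M₂ ⟧ c (map ∗λ xs)) }
    }

  fibredMatrix : Matrix (C₁ ⊎ˢ C₂)
  fibredMatrix = record
    { algebra    = fibredAlgebra
    ; Designated = Designated M₁ ⟨⊎⟩ Designated M₂
    }

  fibring : Logic ℓ
  fibring = matrixLogic fibredMatrix

{-# OPTIONS --safe #-}
-- A valuation into the fibred matrix, followed by ∗μ and restricted to L(C₁),
-- is an M₁-valuation, and the two agree (up to inj₁) on every formula of L(C₁)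
-- that is not a variable.  A variable is never valid in M₁, since then every
-- element of A₁ would be designated and the logic would be trivial.
-- Conversely every M₁-valuation extends to the fibred matrix by composing its
-- values on the variables with inj₁.
module Submission where

open import Level using (Level)
open import Data.Empty using (⊥-elim)
open import Data.Nat.Base using (ℕ)
open import Data.Product.Base using (_×_; _,_)
open import Data.Sum.Base using (inj₁; inj₂)
open import Data.Vec.Base using (Vec; []; _∷_; map)
open import Data.Vec.Properties using (map-∘)
open import Function.Base using (_∘_; const)
open import Function.Bundles using (_⇔_; mk⇔; Equivalence)
open import Function.Construct.Identity using (⇔-id)
open import Relation.Binary.PropositionalEquality
  using (_≡_; refl; sym; trans; cong; cong₂; subst; module ≡-Reasoning)
open import Relation.Nullary.Negation.Core using (¬_)
open import Relation.Unary using (_∈_)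
open import Relation.Unary.Polymorphic using (∅)
open import Defs

private
  variable
    ℓ : Level

module _ {C : Signature ℓ} (A : Algebra C) (e : ℕ → Carrier A) where

  -- `evals` is spelled out because `map eval` would hide the structural descent from the
  -- termination checker; `evals≡map` restores the form that `hom` asks for.
  eval  : Formula C → Carrier A
  evals : ∀ {k} → Vec (Formula C) k → Vec (Carrier A) k

  eval (var n)    = e n
  eval (con c φs) = ⟦ A ⟧ c (evals φs)

  evals []       = []
  evals (φ ∷ φs) = eval φ ∷ evals φs

  evals≡map : ∀ {k} (φs : Vec (Formula C) k) → evals φs ≡ map eval φs
  evals≡map []       = refl
  evals≡map (φ ∷ φs) = cong (eval φ ∷_) (evals≡map φs)

  evaluation : Homomorphism (L C) A
  evaluation = record
    { fun = eval
    ; hom = λ c φs → cong (⟦ A ⟧ c) (evals≡map φs)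
    }

translates≡map : {C C′ : Signature ℓ} (σ : ∀ {k} → C k → C′ k) →
  ∀ {k} (φs : Vec (Formula C) k) → translates σ φs ≡ map (translate σ) φs
translates≡map σ []       = refl
translates≡map σ (φ ∷ φs) = cong (translate σ φ ∷_) (translates≡map σ φs)

validity : {C : Signature ℓ} (M : Matrix C) {φ : Formula C} →
  Consequence M ∅ φ ⇔ ((v : Valuation M) → fun v φ ∈ Designated M)
validity M = mk⇔ (λ ⊨φ v → ⊨φ v λ _ ()) (λ ⊨φ v _ → ⊨φ v)

variable-not-valid : {C : Signature ℓ} (M : Matrix C) → NonTrivial (matrixLogic M) →
  ∀ n → ¬ Consequence M ∅ (var n)
variable-not-valid M nontrivial n ⊨n = nontrivial λ _ φ v _ →
  -- The constant assignment gives the variable the value `fun v φ`, which is therefore designated.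
  Equivalence.to (validity M) ⊨n (evaluation (algebra M) (const (fun v φ)))

-- Both halves of the theorem are instances of this setting: `ι` is the injection of one universe
-- into the disjoint union and `π` is the matching `∗μ` or `∗λ`.
module _ {C C′ : Signature ℓ} (σ : ∀ {k} → C k → C′ k)
  (M : Matrix C) (M′ : Matrix C′)
  (ι : Universe M → Universe M′) (π : Universe M′ → Universe M)
  (π∘ι : ∀ a → π (ι a) ≡ a)
  (operation : ∀ {k} (c : C k) xs →
    ⟦ algebra M′ ⟧ (σ c) xs ≡ ι (⟦ algebra M ⟧ c (map π xs)))
  (designated : ∀ a → a ∈ Designated M ⇔ ι a ∈ Designated M′)
  where

  module _ (v : Valuation M′) where

    restricted : Formula C → Universe M
    restricted = π ∘ fun v ∘ translate σ

    -- Operations from `C` read their arguments through `π` and land in the image of `ι`. The value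
    -- of a variable may lie outside that image.
    compound-value : ∀ {k} (c : C k) φs →
      fun v (translate σ (con c φs)) ≡ ι (⟦ algebra M ⟧ c (map restricted φs))
    compound-value c φs = begin
      fun v (con (σ c) (translates σ φs))
        ≡⟨ hom v (σ c) (translates σ φs) ⟩
      ⟦ algebra M′ ⟧ (σ c) (map (fun v) (translates σ φs))
        ≡⟨ operation c _ ⟩
      ι (⟦ algebra M ⟧ c (map π (map (fun v) (translates σ φs))))
        ≡⟨ cong (ι ∘ ⟦ algebra M ⟧ c) arguments ⟩
      ι (⟦ algebra M ⟧ c (map restricted φs)) ∎
      where
      open ≡-Reasoning
      arguments : map π (map (fun v) (translates σ φs)) ≡ map restricted φs
      arguments = begin
        map π (map (fun v) (translates σ φs))
          ≡⟨ map-∘ π (fun v) (translates σ φs) ⟨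
        map (π ∘ fun v) (translates σ φs)
          ≡⟨ cong (map (π ∘ fun v)) (translates≡map σ φs) ⟩
        map (π ∘ fun v) (map (translate σ) φs)
          ≡⟨ map-∘ (π ∘ fun v) (translate σ) φs ⟨
        map restricted φs ∎

    restriction : Valuation M
    restriction = record
      { fun = restricted
      ; hom = λ c φs → trans (cong π (compound-value c φs)) (π∘ι _)
      }

  module _ (v : Valuation M) where

    extension : Valuation M′
    extension = evaluation (algebra M′) (ι ∘ fun v ∘ var)

    -- Mutual induction: `compound-value` leaves the arguments under `π`, which cancels the `ι`
    -- given by the induction hypothesis.
    extension-translate  : ∀ φ → fun extension (translate σ φ) ≡ ι (fun v φ)
    extension-translates : ∀ {k} (φs : Vec (Formula C) k) →
      map (restricted extension) φs ≡ map (fun v) φs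

    extension-translate (var n)    = refl
    extension-translate (con c φs) = begin
      fun extension (translate σ (con c φs))
        ≡⟨ compound-value extension c φs ⟩
      ι (⟦ algebra M ⟧ c (map (restricted extension) φs))
        ≡⟨ cong (ι ∘ ⟦ algebra M ⟧ c) (extension-translates φs) ⟩
      ι (⟦ algebra M ⟧ c (map (fun v) φs))
        ≡⟨ cong ι (hom v c φs) ⟨
      ι (fun v (con c φs)) ∎
      where open ≡-Reasoning

    extension-translates []       = refl
    extension-translates (φ ∷ φs) =
      cong₂ _∷_ (trans (cong π (extension-translate φ)) (π∘ι _)) (extension-translates φs)

  weakConservativeExtension : NonTrivial (matrixLogic M) →
    WeakConservativeExtension (matrixLogic M) (matrixLogic M′) σ
  weakConservativeExtension nontrivial φ = mk⇔ (preserve φ) reflect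
    where
    preserve : ∀ φ → Consequence M ∅ φ → Consequence M′ ∅ (translate σ φ)
    -- A valuation into `M′` may send a variable outside the image of `ι`, where designation in `M`
    -- says nothing, so this case has to be refuted.
    preserve (var n)    ⊨φ = ⊥-elim (variable-not-valid M nontrivial n ⊨φ)
    preserve (con c φs) ⊨φ = Equivalence.from (validity M′) λ v →
      subst (Designated M′)
        -- Both ends equal `ι` of the operation of `c` at the restricted arguments.
        (trans (cong ι (hom (restriction v) c φs)) (sym (compound-value v c φs)))
        (Equivalence.to (designated _) (Equivalence.to (validity M) ⊨φ (restriction v)))

    reflect : Consequence M′ ∅ (translate σ φ) → Consequence M ∅ φ
    reflect ⊨φ = Equivalence.from (validity M) λ v →
      Equivalence.from (designated _)
        (subst (Designated M′) (extension-translate v φ)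
          (Equivalence.to (validity M′) ⊨φ (extension v)))

proposition3p5 : ∀ {ℓ : Level} {C₁ C₂ : Signature ℓ} (M₁ : Matrix C₁) (M₂ : Matrix C₂)
    (pair : FibringPair M₁ M₂) →
    NonTrivial (matrixLogic M₁) →
    NonTrivial (matrixLogic M₂) →
    WeakConservativeExtension (matrixLogic M₁) (fibring M₁ M₂ pair) inj₁ ×
    WeakConservativeExtension (matrixLogic M₂) (fibring M₁ M₂ pair) inj₂
proposition3p5 M₁ M₂ pair nontrivial₁ nontrivial₂ =
  weakConservativeExtension inj₁ M₁ (fibredMatrix M₁ M₂ pair) inj₁ (∗μ M₁ M₂ pair)
    -- The retraction, the fibred operations and the designated set are all defined by cases on the
    -- injection, so each condition holds by computation.
    (λ _ → refl) (λ _ _ → refl) (λ _ → ⇔-id _) nontrivial₁ ,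
  weakConservativeExtension inj₂ M₂ (fibredMatrix M₁ M₂ pair) inj₂ (∗λ M₁ M₂ pair)
    (λ _ → refl) (λ _ _ → refl) (λ _ → ⇔-id _) nontrivial₂
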